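{- Let $r \geq 2$, let $H$ be a digraph (possibly with loops), and let $D$ be an $H$-colored $r$-transitive digraph. For every $l \geq r-1$ and every $k \geq 2$, $D$ has a $(k,l,H)$-kernel.
   Context: All digraphs are finite. A digraph $D$ is $r$-transitive if for all distinct $u,v\in V(D)$, whenever there is a directed $uv$-path of length $r$, the arc $(u,v)$ belongs to $A(D)$. $D$ has no loops and comes with a map $\rho: A(D)\to V(H)$. For a walk $W=(x_0,\ldots,x_n)$ in $D$, there is an obstruction on $x_i$ if $(\rho(x_{i-1},x_i),\rho(x_i,x_{i+1})) \notin A(H)$; for an open walk this is considered at internal vertices $x_i$, $1\le i\le n-1$, for a closed walk at all $i\in\{0,\ldots,n-1\}$ with indices modulo $n$. $O_H(W)$ is the set of indices with an obstruction; the $H$-length is $l_H(W)=|O_H(W)|+1$ for open $W$ and $|O_H(W)|$ for closed $W$. For $k\ge 2$ and $l\ge 1$, a $(k,l,H)$-kernel is a set $S\subseteq V(D)$ such that for every two distinct $u,v\in S$ every directed $uv$-path in $D$ has $H$-length at least $k$, and for every $x\in V(D)\setminus S$ there is a directed path from $x$ to a vertex of $S$ of $H$-length at most $l$. -}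

module Defs where

open import Data.Bool.Base using (not)
open import Data.Fin.Base using (Fin)
open import Data.Fin.Properties using (_≟_)
open import Data.Fin.Subset using (Subset; ∣_∣; _∈_; _∉_)
open import Data.Nat.Base using (ℕ; zero; suc; pred; _≤_)
open import Data.Product.Base using (∃-syntax; _×_)
open import Data.Vec.Base using (Vec; []; _∷_; init; tail; last; zipWith)
open import Data.Vec.Relation.Unary.Unique.Propositional using (Unique)
open import Level using (0ℓ)
open import Relation.Binary.Core using (Rel)
open import Relation.Binary.Definitions using (Decidable; Irrelevant)
open import Relation.Binary.PropositionalEquality.Core using (_≢_)
open import Relation.Nullary.Decidable.Core using (does; yes; no)
open import Relation.Nullary.Negation.Core using (¬_)

-- Finite digraphs, loops allowed. Decidability and irrelevance of Arc say
-- that the arcs form a (finite) subset of the set of ordered pairs of vertices.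
record Digraph : Set₁ where
  field
    order          : ℕ

  Vertex : Set
  Vertex = Fin order

  field
    Arc            : Rel Vertex 0ℓ
    arc?           : Decidable Arc
    arc-irrelevant : Irrelevant Arc

module _ (D : Digraph) where
  open Digraph D

  Loopless : Set
  Loopless = ∀ v → ¬ Arc v v

  -- Walks, indexed by length (the number of arcs) and end vertices.
  data Walk : ℕ → Vertex → Vertex → Set where
    []  : ∀ {u} → Walk zero u u
    _∷_ : ∀ {n u v w} → Arc u v → Walk n v w → Walk (suc n) u w

module _ {D : Digraph} where
  open Digraph D

  vertices : ∀ {n u v} → Walk D n u v → Vec Vertex (suc n)
  vertices {u = u} []      = u ∷ []
  vertices {u = u} (a ∷ W) = u ∷ vertices W

  IsPath : ∀ {n u v} → Walk D n u v → Set
  IsPath W = Unique (vertices W)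

_-Transitive_ : ℕ → Digraph → Set
r -Transitive D = ∀ {u v} → u ≢ v → (P : Walk D r u v) → IsPath P → Arc u v
  where open Digraph D

record ColoredDigraph (H : Digraph) : Set₁ where
  field
    digraph  : Digraph

  open Digraph digraph public

  field
    loopless : Loopless digraph
    ρ        : ∀ {u v} → Arc u v → Digraph.Vertex H

module _ {H : Digraph} (D : ColoredDigraph H) where
  open ColoredDigraph D

  colors : ∀ {n u v} → Walk digraph n u v → Vec (Digraph.Vertex H) n
  colors []      = []
  colors (a ∷ W) = ρ a ∷ colors W

  -- The positions at which (cᵢ , dᵢ) is not an arc of H.
  nonArcs : ∀ {n} (c d : Vec (Digraph.Vertex H) n) → Subset n
  nonArcs = zipWith (λ c d → not (does (Digraph.arc? H c d)))

  -- For arc colors c₀ , … , cₙ₋₁ of a walk (x₀ , … , xₙ), the vertex xᵢ is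
  -- judged by (cᵢ₋₁ , cᵢ). In an open walk only x₁ , … , xₙ₋₁ are judged, and
  -- position j of the subset stands for x_{j+1}.
  openObstructions : ∀ {n} → Vec (Digraph.Vertex H) n → Subset (pred n)
  openObstructions []         = []
  openObstructions cs@(_ ∷ _) = nonArcs (init cs) (tail cs)

  -- In a closed walk x₀ , … , xₙ₋₁ are judged, x₀ by (cₙ₋₁ , c₀), and
  -- position i stands for xᵢ.
  closedObstructions : ∀ {n} → Vec (Digraph.Vertex H) n → Subset n
  closedObstructions []         = []
  closedObstructions cs@(_ ∷ _) = nonArcs (last cs ∷ init cs) cs

  H-length : ∀ {n u v} → Walk digraph n u v → ℕ
  H-length {u = u} {v} W with u ≟ v
  ... | no  _ = suc ∣ openObstructions (colors W) ∣
  ... | yes _ = ∣ closedObstructions (colors W) ∣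

  record IsKernel (k l : ℕ) (S : Subset order) : Set where
    field
      independent : ∀ {u v} → u ∈ S → v ∈ S → u ≢ v →
                    ∀ {n} (P : Walk digraph n u v) → IsPath P → k ≤ H-length P
      absorbent   : ∀ {x} → x ∉ S →
                    ∃[ v ] v ∈ S × ∃[ n ] ∃[ P ]
                      IsPath {n = n} {x} {v} P × H-length P ≤ l

{-# OPTIONS --safe #-}
-- In an r-transitive digraph every walk can be shortened to a path of length
-- less than r with the same ends, and the H-length of an open path is at most
-- its length. So it is enough to choose one vertex (the least one) from each
-- terminal strong component: distinct chosen vertices are joined by no walk at
-- all, and every vertex has a walk to a chosen one.
module Submission where

open import Defs
open import Data.Fin.Base using (Fin; _<_)
open import Data.Fin.Induction using (Acc; acc; spo-wellFounded)
open import Data.Fin.Properties as Fin using (any?; _≟_; _<?_; <-cmp)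
open import Data.Fin.Subset using (Subset; _∈_; _∉_)
open import Data.Fin.Subset.Properties using (∣p∣≤n)
open import Data.Nat.Base as ℕ using (ℕ; zero; suc; _≤_; _∸_; s≤s; z≤n)
open import Data.Nat.Properties as ℕ using (anyUpTo?; m≤n⇒m<n∨m≡n)
open import Data.Product.Base using (∃-syntax; _×_; _,_; proj₁; proj₂)
open import Data.Sum.Base using (_⊎_; inj₁; inj₂)
open import Data.Vec.Base using (tabulate)
open import Data.Vec.Properties using ([]=⇒lookup; lookup⇒[]=; lookup∘tabulate)
open import Data.Vec.Relation.Unary.All using (All; []; _∷_)
open import Data.Vec.Relation.Unary.AllPairs.Core using ([]; _∷_)
open import Function.Base using (_∘_)
open import Level using (0ℓ)
open import Relation.Binary.Core using (Rel)
open import Relation.Binary.Definitions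
  using (Reflexive; Transitive; Decidable; tri<; tri≈; tri>)
open import Relation.Binary.PropositionalEquality
  using (_≡_; _≢_; refl; sym; trans; isEquivalence; resp₂)
open import Relation.Binary.Structures using (IsStrictPartialOrder)
open import Relation.Nullary.Decidable
  using (Dec; yes; no; does; _×-dec_; _→-dec_; ¬?; map′; dec-true)
open import Relation.Nullary.Negation using (¬_; contradiction)
import Relation.Unary as U using (Decidable)

module _ {n : ℕ} {P : Fin n → Set} (P? : U.Decidable P) where

  subset : Subset n
  subset = tabulate (does ∘ P?)

  ∈-subset⁺ : ∀ {i} → P i → i ∈ subset
  ∈-subset⁺ {i} p =
    lookup⇒[]= i subset (trans (lookup∘tabulate _ i) (dec-true (P? i) p))

  ∈-subset⁻ : ∀ {i} → i ∈ subset → P i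
  ∈-subset⁻ {i} i∈ with P? i | trans (sym (lookup∘tabulate (does ∘ P?) i)) ([]=⇒lookup i∈)
  ... | yes p | _ = p
  ... | no  _ | ()

module TerminalRepresentatives {n : ℕ} {_⇝_ : Rel (Fin n) 0ℓ}
  (⇝-refl : Reflexive _⇝_) (⇝-trans : Transitive _⇝_) (_⇝?_ : Decidable _⇝_) where

  infix 4 _≺_ _≺?_

  -- w ≺ v: the strong component of w lies strictly beyond that of v, or the
  -- components agree and w < v.
  _≺_ : Rel (Fin n) 0ℓ
  w ≺ v = v ⇝ w × (w ⇝ v → w < v)

  _≺?_ : Decidable _≺_
  w ≺? v = v ⇝? w ×-dec (w ⇝? v →-dec w <? v)

  ≺-isStrictPartialOrder : IsStrictPartialOrder _≡_ _≺_
  ≺-isStrictPartialOrder = record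
    { isEquivalence = isEquivalence
    ; irrefl        = λ { refl (_ , f) → Fin.<-irrefl refl (f ⇝-refl) }
    -- A walk back from `u` to `w` puts all three vertices in one strong component, so both `f` and
    -- `g` apply.
    ; trans         = λ (v⇝u , f) (w⇝v , g) → ⇝-trans w⇝v v⇝u ,
        λ u⇝w → Fin.<-trans (f (⇝-trans u⇝w w⇝v)) (g (⇝-trans v⇝u u⇝w))
    ; <-resp-≈      = resp₂ _≺_
    }

  -- Minimality under `≺` says both that the strong component of `v` is terminal and that `v` is its
  -- least vertex.
  Representative : Fin n → Set
  Representative v = ¬ (∃[ w ] w ≺ v)

  representative? : U.Decidable Representative
  representative? v = ¬? (any? (_≺? v))

  -- There must be a walk back, as otherwise `v ≺ u`. Both vertices then lie in one component, where
  -- the larger of two distinct ones is not minimal.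
  representative-unique : ∀ {u v} → Representative u → Representative v → u ⇝ v → u ≡ v
  representative-unique {u} {v} Ru Rv u⇝v with v ⇝? u | <-cmp u v
  ... | no  v⇝̸u | _            = contradiction (v , u⇝v , λ v⇝u → contradiction v⇝u v⇝̸u) Ru
  ... | yes v⇝u | tri< u<v _ _ = contradiction (u , v⇝u , λ _ → u<v) Rv
  ... | yes _   | tri≈ _ u≡v _ = u≡v
  ... | yes _   | tri> _ _ v<u = contradiction (v , u⇝v , λ _ → v<u) Ru

  -- A strict order on a finite set is well founded, so descent along `≺` ends, and each step down
  -- follows `⇝`.
  reach-representative : ∀ x → ∃[ v ] x ⇝ v × Representative v
  reach-representative x = descend (spo-wellFounded ≺-isStrictPartialOrder x)
    where
    descend : ∀ {x} → Acc _≺_ x → ∃[ v ] x ⇝ v × Representative v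
    descend {x} (acc rs) with any? (_≺? x)
    ... | no  x-minimal = x , ⇝-refl , x-minimal
    ... | yes (w , w≺x) with descend (rs w≺x)
    ...   | v , w⇝v , Rv = v , ⇝-trans (proj₁ w≺x) w⇝v , Rv

module _ {D : Digraph} where
  open Digraph D

  _++_ : ∀ {m n u v w} → Walk D m u v → Walk D n v w → Walk D (m ℕ.+ n) u w
  []      ++ W = W
  (a ∷ V) ++ W = a ∷ (V ++ W)

  walk? : ∀ n u v → Dec (Walk D n u v)
  walk? zero u v = map′ (λ { refl → [] }) (λ { [] → refl }) (u ≟ v)
  walk? (suc n) u w = map′ (λ (_ , a , W) → a ∷ W) (λ { (a ∷ W) → _ , a , W })
    (any? λ v → arc? u v ×-dec walk? n v w)

  ShortPath : ℕ → Rel Vertex 0ℓ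
  ShortPath r u v = ∃[ n ] n ℕ.< r × ∃[ P ] IsPath {D} {n} {u} {v} P

  -- If `x` occurs on `P`, the part of `P` from `x` on is a path no longer than `P`.
  avoids-or-suffix : ∀ x {n u v} (P : Walk D n u v) → IsPath P →
    All (x ≢_) (vertices P) ⊎ ShortPath (suc n) x v
  avoids-or-suffix x {u = u} P P! with x ≟ u
  avoids-or-suffix x P        P!        | yes refl = inj₂ (_ , ℕ.≤-refl , P , P!)
  avoids-or-suffix x []       P!        | no x≢u   = inj₁ (x≢u ∷ [])
  avoids-or-suffix x (a ∷ P)  (_ ∷ P!)  | no x≢u with avoids-or-suffix x P P!
  ... | inj₁ x∉P                = inj₁ (x≢u ∷ x∉P)
  ... | inj₂ (m , m<n , Q , Q!) = inj₂ (m , ℕ.m≤n⇒m≤1+n m<n , Q , Q!)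

  avoids-end : ∀ {x n u v} (P : Walk D n u v) → All (x ≢_) (vertices P) → x ≢ v
  avoids-end []      (x≢v ∷ []) = x≢v
  avoids-end (_ ∷ P) (_ ∷ x∉P)  = avoids-end P x∉P

  -- Induction on the walk: the first arc is put before the shortened rest. If its start recurs, the
  -- cycle is cut off; otherwise the length grows by one, and the bound fails only at length exactly
  -- `r`, where transitivity applies.
  shorten : ∀ {r} → 2 ≤ r → r -Transitive D →
            ∀ {n u v} → Walk D n u v → ShortPath r u v
  shorten 2≤r _ [] = 0 , ℕ.<-trans (s≤s z≤n) 2≤r , [] , [] ∷ []
  shorten 2≤r r-trans (_∷_ {u = u} a W) with shorten 2≤r r-trans W
  ... | m , m<r , P , P! with avoids-or-suffix u P P!
  ...   | inj₂ (k , k≤m , Q , Q!) = k , ℕ.<-≤-trans k≤m m<r , Q , Q!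
  ...   | inj₁ u∉P with m≤n⇒m<n∨m≡n m<r
  ...     | inj₁ 1+m<r = suc m , 1+m<r , a ∷ P , u∉P ∷ P!
  -- Here `suc m` is `r`; the single arc replacing the path is short enough because `1 < r` is
  -- `2≤r`.
  ...     | inj₂ refl  = 1 , 2≤r , r-trans u≢v (a ∷ P) (u∉P ∷ P!) ∷ [] ,
                         (u≢v ∷ []) ∷ [] ∷ []
    where u≢v = avoids-end P u∉P

-- With distinct ends only the `n - 1` internal vertices can add to the initial 1.
H-length≤length : ∀ {H} (D : ColoredDigraph H) {n u v} → u ≢ v →
                  (W : Walk (ColoredDigraph.digraph D) n u v) → H-length D W ≤ n
H-length≤length D {u = u} {v} u≢v W with u ≟ v
H-length≤length D u≢v W       | yes u≡v = contradiction u≡v u≢v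
H-length≤length D u≢v []      | no _    = contradiction refl u≢v
H-length≤length D u≢v (a ∷ W) | no _    = s≤s (∣p∣≤n (openObstructions D (colors D (a ∷ W))))

theorem11 : (r : ℕ) → 2 ≤ r →
    (H : Digraph) (D : ColoredDigraph H) →
    r -Transitive (ColoredDigraph.digraph D) →
    (k l : ℕ) → r ∸ 1 ≤ l → 2 ≤ k →
    ∃[ S ] IsKernel D k l S
theorem11 r 2≤r H D r-trans k l r-1≤l _ = S , record
  { independent = λ u∈S v∈S u≢v P _ → contradiction
      (representative-unique (∈-subset⁻ representative? u∈S) (∈-subset⁻ representative? v∈S)
        (toShortWalk P))
      u≢v
  ; absorbent = absorbent
  }
  where
  open ColoredDigraph D

  -- Bounding the length by r makes reachability decidable at once.
  _⇝_ : Rel Vertex 0ℓ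
  u ⇝ v = ∃[ n ] n ℕ.< r × Walk digraph n u v

  toShortWalk : ∀ {n u v} → Walk digraph n u v → u ⇝ v
  toShortWalk W with shorten 2≤r r-trans W
  ... | n , n<r , P , _ = n , n<r , P

  open TerminalRepresentatives {_⇝_ = _⇝_} (toShortWalk [])
    -- The concatenation may have length `r` or more, so it is shortened again.
    (λ (_ , _ , V) (_ , _ , W) → toShortWalk (V ++ W))
    (λ u v → anyUpTo? (λ n → walk? n u v) r)

  S : Subset order
  S = subset representative?

  absorbent : ∀ {x} → x ∉ S →
    ∃[ v ] v ∈ S × ∃[ n ] ∃[ P ] IsPath {n = n} {x} {v} P × H-length D P ≤ l
  absorbent {x} x∉S with reach-representative x
  -- `W` is short but may repeat vertices; shortening makes it a path.
  ... | v , (_ , _ , W) , Rv with shorten 2≤r r-trans W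
  ...   | n , n<r , P , P! = v , v∈S , n , P , P! ,
          ℕ.≤-trans (H-length≤length D x≢v P) (ℕ.≤-trans (ℕ.∸-monoˡ-≤ 1 n<r) r-1≤l)
    where
    v∈S = ∈-subset⁺ representative? Rv
    x≢v : x ≢ v
    x≢v refl = x∉S v∈S
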